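{- Let $(S,\cdot)$ be a commutative semigroup with identity. Then $$M(\beta S,\mathcal{F}_{(S,\cdot)})=\overline{K(\beta S,\odot)},$$ where the bar denotes closure in the Stone topology of $\beta S$.
   Context: $\mathcal{F}_{(S,\cdot)}$ is the family of all functions $f_r:S\to S$, $f_r(s)=s\cdot r$, for $r\in S$. For $A,B\subseteq S$ and a family $\mathcal{F}$ of functions $S\to S$, $A\leq_{\mathcal{F}}B$ means that for every finite $F\subseteq A$ there is $f\in\mathcal{F}$ with $f(F)\subseteq B$. For $\mathcal{U},\mathcal{V}\in\beta S$, $\mathcal{U}\leq_{\mathcal{F}}\mathcal{V}$ means that for every $B\in\mathcal{V}$ there is $A\in\mathcal{U}$ with $A\leq_{\mathcal{F}}B$. $M(\beta S,\mathcal{F})$ is the set of maximal ultrafilters, i.e. those $\mathcal{U}\in\beta S$ such that $\mathcal{V}\leq_{\mathcal{F}}\mathcal{U}$ for every $\mathcal{V}\in\beta S$. The operation on $\beta S$ is $\mathcal{U}\odot\mathcal{V}=\{A\subseteq S\mid\{s\in S\mid\{r\in S\mid s\cdot r\in A\}\in\mathcal{V}\}\in\mathcal{U}\}$, and $K(\beta S,\odot)$ is the smallest two-sided ideal of $(\beta S,\odot)$. -}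

module Defs where

open import Level using (Level; _⊔_; suc)
open import Algebra.Bundles using (Semigroup)
open import Algebra.Core using (Op₂)
open import Algebra.Structures using (IsSemigroup)
open import Data.List.Base using (List; map)
open import Data.List.Relation.Unary.All using (All)
open import Data.Product.Base using (∃; _×_; _,_; proj₁; proj₂)
open import Data.Sum.Base using (_⊎_; inj₁; inj₂)
open import Function.Base using (id)
open import Relation.Binary.Definitions using (_Respects_)
open import Relation.Binary.PropositionalEquality using (_≡_; _≗_; sym; subst)
open import Relation.Nullary.Negation.Core using (contradiction)
open import Relation.Unary
  using (Pred; _∈_; _∉_; _⊆_; _≐_; _∩_; _≬_; ∁; Satisfiable)
open import Relation.Unary.Polymorphic using (∅; U)

-- An ultrafilter on S.  Keeping membership 𝓤 ∋ A at the level of S itself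
-- makes { s ∣ A s ∈ 𝓤 } a subset of S again, as the product of ultrafilters
-- requires; under excluded middle this restricts nothing.

record Ultrafilter {ℓ} (S : Set ℓ) : Set (suc ℓ) where
  field
    sets       : Pred (Pred S ℓ) ℓ
    full       : U ∈ sets
    proper     : ∅ ∉ sets
    upward     : ∀ {A B} → A ⊆ B → A ∈ sets → B ∈ sets
    intersects : ∀ {A B} → A ∈ sets → B ∈ sets → (A ∩ B) ∈ sets
    ultra      : ∀ A → A ∈ sets ⊎ ∁ A ∈ sets

open Ultrafilter public

module _ {ℓ} {S : Set ℓ} where

  infix 4 _≈_

  _≈_ : Ultrafilter S → Ultrafilter S → Set (suc ℓ)
  𝓤 ≈ 𝓥 = sets 𝓤 ≐ sets 𝓥

  -- The Stone topology on βS: the sets { 𝓤 ∣ A ∈ 𝓤 }, for A ⊆ S, form a base.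

  IsOpen : Pred (Ultrafilter S) (suc ℓ) → Set (suc ℓ)
  IsOpen O = ∀ {𝓤} → 𝓤 ∈ O →
    ∃ λ (A : Pred S ℓ) → A ∈ sets 𝓤 × (∀ {𝓥} → A ∈ sets 𝓥 → 𝓥 ∈ O)

  Closure : ∀ {k} → Pred (Ultrafilter S) k → Pred (Ultrafilter S) (suc (suc ℓ) ⊔ k)
  Closure X 𝓤 = ∀ (O : Pred (Ultrafilter S) (suc ℓ)) → IsOpen O → 𝓤 ∈ O → O ≬ X

  -- Finite subsets are given by lists.

  Embeds : Pred (S → S) ℓ → Pred S ℓ → Pred S ℓ → Set ℓ
  Embeds 𝓕 A B = ∀ (F : List S) → All A F → ∃ λ f → f ∈ 𝓕 × All B (map f F)

  Below : Pred (S → S) ℓ → Ultrafilter S → Ultrafilter S → Set (suc ℓ)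
  Below 𝓕 𝓤 𝓥 = ∀ B → B ∈ sets 𝓥 → ∃ λ A → A ∈ sets 𝓤 × Embeds 𝓕 A B

  Maximal : Pred (S → S) ℓ → Pred (Ultrafilter S) (suc ℓ)
  Maximal 𝓕 𝓤 = ∀ 𝓥 → Below 𝓕 𝓥 𝓤

  Translations : Op₂ S → Pred (S → S) ℓ
  Translations _∙_ f = ∃ λ r → f ≗ (λ s → s ∙ r)

module _ {ℓ} {S : Set ℓ} {_∙_ : Op₂ S} (isSemigroup : IsSemigroup _≡_ _∙_) where

  open IsSemigroup isSemigroup using (assoc)

  infixl 7 _⊙_

  _⊙_ : Op₂ (Ultrafilter S)
  𝓤 ⊙ 𝓥 = record
    { sets       = λ A → (λ s → (λ r → A (s ∙ r)) ∈ sets 𝓥) ∈ sets 𝓤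
    ; full       = upward 𝓤 (λ _ → full 𝓥) (full 𝓤)
    ; proper     = λ ∅∈ → proper 𝓤 (upward 𝓤 (λ ∅∈𝓥 → contradiction ∅∈𝓥 (proper 𝓥)) ∅∈)
    ; upward     = λ A⊆B → upward 𝓤 (upward 𝓥 A⊆B)
    ; intersects = λ A∈ B∈ →
        upward 𝓤 (λ (a , b) → intersects 𝓥 a b) (intersects 𝓤 A∈ B∈)
    ; ultra      = ultra-⊙
    }
    where
    ultra-⊙ : ∀ A →
      (λ s → (λ r → A (s ∙ r)) ∈ sets 𝓥) ∈ sets 𝓤 ⊎
      (λ s → (λ r → ∁ A (s ∙ r)) ∈ sets 𝓥) ∈ sets 𝓤
    ultra-⊙ A with ultra 𝓤 (λ s → (λ r → A (s ∙ r)) ∈ sets 𝓥)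
    ... | inj₁ A∈ = inj₁ A∈
    ... | inj₂ A∉ = inj₂ (upward 𝓤 (λ {s} → flip s) A∉)
      where
      flip : ∀ s → (λ r → A (s ∙ r)) ∉ sets 𝓥 → (λ r → ∁ A (s ∙ r)) ∈ sets 𝓥
      flip s ∉𝓥 with ultra 𝓥 (λ r → A (s ∙ r))
      ... | inj₁ ∈𝓥  = contradiction ∈𝓥 ∉𝓥
      ... | inj₂ ∁∈𝓥 = ∁∈𝓥

  ⊙-cong : ∀ {𝓤 𝓤′ 𝓥 𝓥′} → 𝓤 ≈ 𝓤′ → 𝓥 ≈ 𝓥′ → 𝓤 ⊙ 𝓥 ≈ 𝓤′ ⊙ 𝓥′
  ⊙-cong {𝓤} {𝓤′} (u , u′) (v , v′) =
    (λ A∈ → u (upward 𝓤 v A∈)) , (λ A∈ → u′ (upward 𝓤′ v′ A∈))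

  ⊙-assoc : ∀ 𝓤 𝓥 𝓦 → (𝓤 ⊙ 𝓥) ⊙ 𝓦 ≈ 𝓤 ⊙ (𝓥 ⊙ 𝓦)
  ⊙-assoc 𝓤 𝓥 𝓦 =
    (λ {A} → upward 𝓤 (upward 𝓥 (upward 𝓦 (subst A (assoc _ _ _))))) ,
    (λ {A} → upward 𝓤 (upward 𝓥 (upward 𝓦 (subst A (sym (assoc _ _ _))))))

  β : Semigroup (suc ℓ) (suc ℓ)
  β = record
    { Carrier     = Ultrafilter S
    ; _≈_         = _≈_
    ; _∙_         = _⊙_
    ; isSemigroup = record
      { isMagma = record
        { isEquivalence = record
          { refl  = id , id
          ; sym   = λ (p , q) → q , p
          ; trans = λ (p , q) (p′ , q′) → (λ a → p′ (p a)) , (λ a → q (q′ a))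
          }
        ; ∙-cong = λ {𝓤} {𝓤′} {𝓥} {𝓥′} → ⊙-cong {𝓤} {𝓤′} {𝓥} {𝓥′}
        }
      ; assoc = ⊙-assoc
      }
    }

module _ {c e} (G : Semigroup c e) where
  open Semigroup G using (Carrier; _∙_) renaming (_≈_ to _≈ᴳ_)

  record IsTwoSidedIdeal {k} (I : Pred Carrier k) : Set (c ⊔ e ⊔ k) where
    field
      respects : I Respects _≈ᴳ_
      nonempty : Satisfiable I
      left     : ∀ x {y} → y ∈ I → (x ∙ y) ∈ I
      right    : ∀ {x} y → x ∈ I → (x ∙ y) ∈ I

  -- The smallest two-sided ideal, as the intersection of all of them.

  K : Pred Carrier (suc (c ⊔ e))
  K x = ∀ (I : Pred Carrier (c ⊔ e)) → IsTwoSidedIdeal I → x ∈ I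

  smallest⇒≐K : ∀ {L : Pred Carrier (c ⊔ e)} → IsTwoSidedIdeal L →
    (∀ (I : Pred Carrier (c ⊔ e)) → IsTwoSidedIdeal I → L ⊆ I) → L ≐ K
  smallest⇒≐K ideal least = (λ x∈L I i → least I i x∈L) , (λ x∈K → x∈K _ ideal)

{-# OPTIONS --safe #-}
module Submission where

-- For every ultrafilter 𝓥 the ultrafilters above 𝓥 form a closed two-sided ideal
-- (it is the closure of 𝓥 ⊙ βS), so the closure of K lies in M.
-- Conversely, let 𝓥 ∈ K and let 𝓤 be maximal.  If B ∈ 𝓤, some A ∈ 𝓥 embeds in B, so
-- the sets { r ∣ s ∙ r ∈ B }, s ∈ A, have the finite intersection property; an
-- ultrafilter 𝓦 containing them satisfies B ∈ 𝓥 ⊙ 𝓦 ∈ K.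
--
-- K is nonempty because it contains every minimal left ideal.  In place of a minimal left
-- ideal we take the filter it corresponds to, a family 𝓕 of subsets of S that is
-- maximal among those whose translates have the finite intersection property.  This
-- property has finite character, so 𝓕 exists by Tukey's lemma, which also yields the
-- ultrafilters.  Tukey's lemma follows from excluded middle by the Bourbaki–Witt tower
-- argument.

open import Defs
open import Level using (Level; Lift; lift; lower; suc)
open import Algebra.Core using (Op₂)
open import Algebra.Structures using (IsCommutativeMonoid)
open import Axiom.ExcludedMiddle using (ExcludedMiddle)
open import Axiom.Extensionality.Propositional using (Extensionality)
open import Data.Bool.Base using (Bool; true; false; T; _∨_)
open import Data.Bool.Properties using (T-∨)
open import Data.Empty using (⊥-elim)
open import Data.List.Base using (List; []; _∷_; _++_; map)
open import Data.List.Relation.Binary.Subset.Propositional using () renaming (_⊆_ to _⊆ˡ_)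
open import Data.List.Relation.Binary.Subset.Propositional.Properties
  using (All-resp-⊇; xs⊆x∷xs; ∷⁺ʳ; ∈-∷⁺ʳ)
open import Data.List.Relation.Unary.All as All using (All; []; _∷_)
open import Data.List.Relation.Unary.All.Properties
  using (map⁺; map⁻) renaming (++⁺ to All-++⁺; ++⁻ to All-++⁻)
open import Data.List.Relation.Unary.Any using (here; there)
open import Data.Product.Base using (∃; _×_; _,_; proj₁; proj₂)
open import Data.Sum.Base using (_⊎_; inj₁; inj₂; [_,_]′)
open import Data.Unit.Polymorphic.Base using (tt)
open import Function.Base using (_∘_; id)
open import Function.Bundles using (Equivalence)
open import Relation.Binary.PropositionalEquality using (_≡_; refl; sym; trans; cong; subst)
open import Relation.Nullary.Decidable
  using (Dec; yes; no; isYes; toWitness; fromWitness; decidable-stable)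
open import Relation.Nullary.Negation using (¬_; contradiction)
open import Relation.Unary using (Pred; _∈_; _⊆_; _≐_; _∩_; ∁; Satisfiable)
open import Relation.Unary.Polymorphic using (U)

-- Tukey's lemma by the tower argument.

T-antisym : ∀ {a b} → (T a → T b) → (T b → T a) → a ≡ b
T-antisym {true}  {true}  _ _ = refl
T-antisym {true}  {false} f _ = ⊥-elim (f _)
T-antisym {false} {true}  _ g = ⊥-elim (g _)
T-antisym {false} {false} _ _ = refl

module Tukey (em : ∀ {a} → ExcludedMiddle a) (ext : ∀ {a b} → Extensionality a b)
  {x p : Level} {X : Set x} (P : Pred (List X) p) where

  -- Families are Boolean-valued so that families with the same elements are equal.

  Family : Set x
  Family = X → Bool

  Elements : Family → Pred X _
  Elements G x = T (G x)

  infix 4 _≤_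

  _≤_ : Family → Family → Set x
  G ≤ H = Elements G ⊆ Elements H

  ≤-antisym : ∀ {G H} → G ≤ H → H ≤ G → G ≡ H
  ≤-antisym G≤H H≤G = ext (λ _ → T-antisym G≤H H≤G)

  Consistent : Family → Set _
  Consistent G = ∀ {xs} → All (Elements G) xs → P xs

  Admissible : Family → X → Set _
  Admissible G x = ∀ {xs} → All (Elements G) xs → P (x ∷ xs)

  Extension : Family → X → Set _
  Extension G x = ¬ Elements G x × Admissible G x

  IsMaximal : Family → Set _
  IsMaximal G = Consistent G × (∀ {x} → Admissible G x → Elements G x)

  adjoin : Family → X → Family
  adjoin G x y = G y ∨ isYes (em {P = x ≡ y})

  extend′ : (G : Family) → Dec (∃ (Extension G)) → Family
  extend′ G (yes (x , _)) = adjoin G x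
  extend′ G (no _)        = G

  extend : Family → Family
  extend G = extend′ G em

  extend-increasing : ∀ {G} → G ≤ extend G
  extend-increasing {G} with em {P = ∃ (Extension G)}
  ... | yes _ = Equivalence.from T-∨ ∘ inj₁
  ... | no  _ = id

  ⋃ : (Family → Bool) → Family
  ⋃ 𝓗 x = isYes (em {P = ∃ λ G → T (𝓗 G) × Elements G x})

  ≤-⋃ : ∀ {𝓗 G} → T (𝓗 G) → G ≤ ⋃ 𝓗
  ≤-⋃ G∈ x∈ = fromWitness (_ , G∈ , x∈)

  -- The empty family arises as the union of no stages. `limit` need not ask for chains, because
  -- `linear` shows that the stages form one.
  data Stage : Family → Set x where
    next  : ∀ {G} → Stage G → Stage (extend G)
    limit : ∀ 𝓗 → (∀ {G} → T (𝓗 G) → Stage G) → Stage (⋃ 𝓗)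

  -- A successor is compared with H in both orders; at a limit, either some member already contains
  -- `extend H` or all members lie in H.
  comparable : ∀ {G H} → Stage G → Stage H → G ≤ H ⊎ extend H ≤ G
  comparable {H = H} (next {G} g) h with comparable g h | comparable h g
  ... | inj₂ eH≤G | _         = inj₂ (extend-increasing {G} ∘ eH≤G)
  ... | inj₁ _    | inj₂ eG≤H = inj₁ eG≤H
  -- `extend` chooses an element, so mutual inclusion must become equality before it yields
  -- `extend H ≤ extend G`.
  ... | inj₁ G≤H  | inj₁ H≤G  with refl ← ≤-antisym {G} {H} G≤H H≤G = inj₂ id
  comparable {H = H} (limit 𝓗 stage) h with em {P = ∃ λ G → T (𝓗 G) × extend H ≤ G}
  ... | yes (G , G∈ , eH≤G) = inj₂ (≤-⋃ G∈ ∘ eH≤G)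
  ... | no  none            = inj₁ λ x∈ → let (G , G∈ , x∈G) = toWitness x∈ in
    [ (λ G≤H → G≤H x∈G) , (λ eH≤G → contradiction (G , G∈ , eH≤G) none) ]′
      (comparable (stage G∈) h)

  linear : ∀ {G H} → Stage G → Stage H → G ≤ H ⊎ H ≤ G
  linear {H = H} g h with comparable g h
  ... | inj₁ G≤H  = inj₁ G≤H
  ... | inj₂ eH≤G = inj₂ (eH≤G ∘ extend-increasing {H})

  module _ (P-[] : P []) (P-anti : ∀ {xs ys} → xs ⊆ˡ ys → P ys → P xs) where

    drop-adjoined : ∀ {G x xs} → All (Elements (adjoin G x)) xs →
      ∃ λ ys → All (Elements G) ys × xs ⊆ˡ (x ∷ ys)
    drop-adjoined [] = [] , [] , λ ()
    drop-adjoined {G} {x} {z ∷ _} (z∈ ∷ zs∈) with drop-adjoined zs∈ | Equivalence.to (T-∨ {G z}) z∈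
    ... | ys , ys∈ , ⊆ys | inj₁ z∈G = z ∷ ys , z∈G ∷ ys∈ ,
      ∈-∷⁺ʳ (there (here refl)) (∷⁺ʳ x (xs⊆x∷xs ys z) ∘ ⊆ys)
    ... | ys , ys∈ , ⊆ys | inj₂ x≡z = ys , ys∈ , ∈-∷⁺ʳ (here (sym (toWitness x≡z))) ⊆ys

    -- By `linear`, the largest of finitely many stages contains the list. The empty list is
    -- separate since `𝓗` may have no members.
    bounded : ∀ {𝓗} → (∀ {G} → T (𝓗 G) → Stage G) → ∀ {xs} → All (Elements (⋃ 𝓗)) xs →
      xs ≡ [] ⊎ ∃ λ G → T (𝓗 G) × All (Elements G) xs
    bounded stage [] = inj₁ refl
    bounded stage (x∈ ∷ xs∈) with toWitness x∈ | bounded stage xs∈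
    ... | G , G∈ , x∈G | inj₁ refl = inj₂ (G , G∈ , x∈G ∷ [])
    ... | G , G∈ , x∈G | inj₂ (H , H∈ , xs∈H) with linear (stage G∈) (stage H∈)
    ...   | inj₁ G≤H = inj₂ (H , H∈ , G≤H x∈G ∷ xs∈H)
    ...   | inj₂ H≤G = inj₂ (G , G∈ , x∈G ∷ All.map H≤G xs∈H)

    consistent : ∀ {G} → Stage G → Consistent G
    consistent (next {G} g) with em {P = ∃ (Extension G)}
    ... | no  _             = consistent g
    ... | yes (x , _ , adm) = λ xs∈ →
      let (ys , ys∈ , ⊆ys) = drop-adjoined {G} xs∈ in P-anti ⊆ys (adm ys∈)
    consistent (limit 𝓗 stage) xs∈ with bounded stage xs∈
    ... | inj₁ refl            = P-[]
    ... | inj₂ (G , G∈ , xs∈G) = consistent (stage G∈) xs∈G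

    -- The largest stage, hence one that contains its own extension.
    last : Family
    last = ⋃ (λ G → isYes (em {P = Stage G}))

    stage-last : Stage last
    stage-last = limit _ toWitness

    extend-last : extend last ≤ last
    extend-last = ≤-⋃ (fromWitness (next stage-last))

    no-extension : ∀ {G} → extend G ≤ G → ¬ ∃ (Extension G)
    no-extension {G} eG≤G ∃x with em {P = ∃ (Extension G)}
    ... | yes (x , x∉ , _) = x∉ (eG≤G (Equivalence.from (T-∨ {G x}) (inj₂ (fromWitness refl))))
    ... | no  ∄x           = ∄x ∃x

    tukey : ∃ IsMaximal
    tukey = last , consistent stage-last , λ adm →
      decidable-stable em λ x∉ → no-extension extend-last (_ , x∉ , adm)

-- Elementary facts about ultrafilters.

module _ {ℓ} {S : Set ℓ} where

  ultrafilter-inhabited : (em : ∀ {a} → ExcludedMiddle a) →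
    ∀ (𝓤 : Ultrafilter S) {A} → A ∈ sets 𝓤 → Satisfiable A
  ultrafilter-inhabited em 𝓤 A∈ = decidable-stable em λ A-empty →
    proper 𝓤 (upward 𝓤 (λ s∈ → contradiction (_ , s∈) A-empty) A∈)

  -- The set { s ∣ All (λ i → s ∈ φ i) is } may live in a larger universe than ℓ.

  finite-intersection : ∀ (𝓤 : Ultrafilter S) {i} {I : Set i} {φ : I → Pred S ℓ} {is} →
    All (λ i → φ i ∈ sets 𝓤) is →
    ∃ λ A → A ∈ sets 𝓤 × (∀ {s} → s ∈ A → All (λ i → s ∈ φ i) is)
  finite-intersection 𝓤 []         = U , full 𝓤 , λ _ → []
  finite-intersection 𝓤 {φ = φ} {is = i ∷ _} (i∈ ∷ is∈) =
    let (A , A∈ , A⊆) = finite-intersection 𝓤 is∈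
    in φ i ∩ A , intersects 𝓤 i∈ A∈ , λ (s∈i , s∈A) → s∈i ∷ A⊆ s∈A

  common-point : (em : ∀ {a} → ExcludedMiddle a) →
    ∀ (𝓤 : Ultrafilter S) {i} {I : Set i} {φ : I → Pred S ℓ} {is} →
    All (λ i → φ i ∈ sets 𝓤) is → ∃ λ s → All (λ i → s ∈ φ i) is
  common-point em 𝓤 {φ = φ} is∈ =
    let (A , A∈ , A⊆) = finite-intersection 𝓤 {φ = φ} is∈
        (s , s∈A) = ultrafilter-inhabited em 𝓤 A∈
    in s , A⊆ s∈A

  ultrafilters-maximal : ∀ (𝓤 𝓥 : Ultrafilter S) → sets 𝓤 ⊆ sets 𝓥 → 𝓤 ≈ 𝓥
  ultrafilters-maximal 𝓤 𝓥 𝓤⊆𝓥 = 𝓤⊆𝓥 , λ {A} A∈ → [ id , (λ ∁A∈ → contradiction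
    (upward 𝓥 (λ (a , ¬a) → contradiction a ¬a) (intersects 𝓥 A∈ (𝓤⊆𝓥 ∁A∈))) (proper 𝓥)) ]′ (ultra 𝓤 A)

-- The ultrafilter lemma.

module _ (em : ∀ {a} → ExcludedMiddle a) (ext : ∀ {a b} → Extensionality a b)
  {ℓ} {S : Set ℓ} where

  FIP : ∀ {i} {I : Set i} → (I → Pred S ℓ) → Set _
  FIP φ = ∀ is → ∃ λ s → All (λ i → s ∈ φ i) is

  ultrafilter-lemma : ∀ {i} {I : Set i} (φ : I → Pred S ℓ) → FIP φ →
    ∃ λ (𝓤 : Ultrafilter S) → ∀ i → φ i ∈ sets 𝓤
  ultrafilter-lemma φ fip = 𝓤 , λ i → lift (maximal λ xs∈ is →
      let (s , s∈xs , s∈is) = consistent xs∈ (i ∷ is) in s , All.head s∈is ∷ s∈xs , All.tail s∈is)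
    where
    -- With `φ` built into the predicate, each `φ i` is admissible for every consistent family, so a
    -- maximal one contains it.
    Meets : Pred (List (Pred S ℓ)) _
    Meets As = ∀ is → ∃ λ s → All (s ∈_) As × All (λ i → s ∈ φ i) is

    open Tukey em ext Meets using (Family; Elements; Consistent; Admissible; IsMaximal; tukey)

    maximal-family : ∃ IsMaximal
    maximal-family = tukey
      (λ is → let (s , s∈) = fip is in s , [] , s∈)
      (λ xs⊆ys meets is → let (s , s∈ys , s∈is) = meets is in s , All-resp-⊇ xs⊆ys s∈ys , s∈is)

    G : Family
    G = proj₁ maximal-family

    consistent : Consistent G
    consistent = proj₁ (proj₂ maximal-family)

    maximal : ∀ {A} → Admissible G A → Elements G A
    maximal = proj₂ (proj₂ maximal-family)

    -- If `∁ A` misses a finite intersection of members of `G` and sets `φ i`, that intersection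
    -- lies in A; then A is admissible, so `G` contains it.
    ∁-admissible : ∀ {A} → ¬ Elements G A → Admissible G (∁ A)
    ∁-admissible {A} A∉ {xs} xs∈ is = decidable-stable em λ none → A∉ (maximal λ {ys} ys∈ js →
      let (s , s∈xys , s∈ijs) = consistent (All-++⁺ xs∈ ys∈) (is ++ js)
          (s∈xs , s∈ys) = All-++⁻ xs s∈xys
          (s∈is , s∈js) = All-++⁻ is s∈ijs
      in s , decidable-stable em (λ s∉A → none (s , s∉A ∷ s∈xs , s∈is)) ∷ s∈ys , s∈js)

    𝓤 : Ultrafilter S
    𝓤 = record
      { sets       = λ A → Lift ℓ (Elements G A)
      ; full       = lift (maximal λ xs∈ is →
          let (s , s∈xs , s∈is) = consistent xs∈ is in s , tt ∷ s∈xs , s∈is)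
      ; proper     = λ (lift ∅∈) → lower (All.head (proj₁ (proj₂ (consistent (∅∈ ∷ []) []))))
      ; upward     = λ A⊆B (lift A∈) → lift (maximal λ xs∈ is →
          let (s , s∈ , s∈is) = consistent (A∈ ∷ xs∈) is in s , A⊆B (All.head s∈) ∷ All.tail s∈ , s∈is)
      ; intersects = λ (lift A∈) (lift B∈) → lift (maximal λ xs∈ is →
          let (s , s∈ , s∈is) = consistent (A∈ ∷ B∈ ∷ xs∈) is
          in s , (All.head s∈ , All.head (All.tail s∈)) ∷ All.tail (All.tail s∈) , s∈is)
      ; ultra      = λ A → ultra-G A em
      }
      where
      ultra-G : ∀ A → Dec (Elements G A) → Lift ℓ (Elements G A) ⊎ Lift ℓ (Elements G (∁ A))
      ultra-G A (yes A∈) = inj₁ (lift A∈)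
      ultra-G A (no A∉)  = inj₂ (lift (maximal (∁-admissible A∉)))

-- Nonemptiness of the smallest ideal.

module _ (em : ∀ {a} → ExcludedMiddle a) (ext : ∀ {a b} → Extensionality a b)
  {ℓ} {S : Set ℓ} {_∙_ : Op₂ S} {ε : S} (isCM : IsCommutativeMonoid _≡_ _∙_ ε) where

  open IsCommutativeMonoid isCM using (assoc; comm; identityˡ; identityʳ; isSemigroup)

  private
    βS = β isSemigroup

    infixl 7 _·_
    _·_ : Op₂ (Ultrafilter S)
    _·_ = _⊙_ isSemigroup

  K-rightIdeal : ∀ {𝓤} 𝓥 → 𝓤 ∈ K βS → (𝓤 · 𝓥) ∈ K βS
  K-rightIdeal {𝓤} 𝓥 𝓤∈K I isIdeal = IsTwoSidedIdeal.right isIdeal {𝓤} 𝓥 (𝓤∈K I isIdeal)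

  -- An ideal containing `𝓧` contains `𝓧 · 𝓥`, and hence `𝓥` once `𝓦 · (𝓧 · 𝓥) ≈ 𝓥` for some `𝓦`.
  K-satisfiable : Satisfiable (K βS)
  K-satisfiable = 𝓥 , λ I isIdeal →
    let open IsTwoSidedIdeal isIdeal
        (𝓧 , 𝓧∈I) = nonempty
        (𝓦 , 𝓦𝓧𝓥≈𝓥) = returns 𝓧
    in respects {𝓦 · (𝓧 · 𝓥)} {𝓥} 𝓦𝓧𝓥≈𝓥 (left 𝓦 {𝓧 · 𝓥} (right {𝓧} 𝓥 𝓧∈I))
    where
    TranslatesMeet : Pred (List (Pred S ℓ)) (suc ℓ)
    TranslatesMeet As = ∀ ss → ∃ λ r → All (λ A → All (λ s → (s ∙ r) ∈ A) ss) As

    open Tukey em ext TranslatesMeet using (Family; Elements; Consistent; Admissible; IsMaximal; tukey)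

    maximal-family : ∃ IsMaximal
    maximal-family = tukey (λ _ → ε , [])
      (λ xs⊆ys meet ss → let (r , r∈) = meet ss in r , All-resp-⊇ xs⊆ys r∈)

    𝓕 : Family
    𝓕 = proj₁ maximal-family

    consistent : Consistent 𝓕
    consistent = proj₁ (proj₂ maximal-family)

    maximal : ∀ {A} → Admissible 𝓕 A → Elements 𝓕 A
    maximal = proj₂ (proj₂ maximal-family)

    translates : ∃ (Elements 𝓕) × S → Pred S ℓ
    translates ((A , _) , s) r = (s ∙ r) ∈ A

    translates-FIP : FIP em ext translates
    translates-FIP is =
      let (r , r∈) = consistent (map⁺ (All.universal (proj₂ ∘ proj₁) is)) (map proj₂ is)
      in r , All.tabulate λ i∈ → All.lookup (map⁻ (All.lookup (map⁻ r∈) i∈)) i∈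

    ∃𝓥 : ∃ λ (𝓥 : Ultrafilter S) → ∀ i → translates i ∈ sets 𝓥
    ∃𝓥 = ultrafilter-lemma em ext translates translates-FIP

    𝓥 : Ultrafilter S
    𝓥 = proj₁ ∃𝓥

    𝓕-translate∈𝓥 : ∀ {A} → Elements 𝓕 A → ∀ s → (λ r → (s ∙ r) ∈ A) ∈ sets 𝓥
    𝓕-translate∈𝓥 A∈ s = proj₂ ∃𝓥 ((_ , A∈) , s)

    𝓕⊆𝓥 : ∀ {A} → Elements 𝓕 A → A ∈ sets 𝓥
    𝓕⊆𝓥 {A} A∈ = upward 𝓥 (subst A (identityˡ _)) (𝓕-translate∈𝓥 A∈ ε)

    module _ (𝓧 : Ultrafilter S) where

      𝓩 : Ultrafilter S
      𝓩 = 𝓧 · 𝓥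

      -- By associativity, translating by s and then by t is translating by `s ∙ t`, which stays in
      -- `𝓥` for every t.
      𝓕-translate∈𝓩 : ∀ {A} → Elements 𝓕 A → ∀ s → (λ r → (s ∙ r) ∈ A) ∈ sets 𝓩
      𝓕-translate∈𝓩 {A} A∈ s = upward 𝓧
        (λ {t} _ → upward 𝓥 (subst A (assoc s t _)) (𝓕-translate∈𝓥 A∈ (s ∙ t))) (full 𝓧)

      -- The sets with all translates in `𝓩` jointly satisfy `TranslatesMeet` and include `𝓕`, so by
      -- maximality they are exactly `𝓕`.
      maximal-𝓩 : ∀ {A} → (∀ s → (λ r → (s ∙ r) ∈ A) ∈ sets 𝓩) → Elements 𝓕 A
      maximal-𝓩 {A} A∈ = maximal λ xs∈ ss →
        let all-translates : ∀ B → (∀ s → (λ r → (s ∙ r) ∈ B) ∈ sets 𝓩) →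
              (λ r → All (λ s → (s ∙ r) ∈ B) ss) ∈ sets 𝓩
            all-translates B B∈ =
              let (C , C∈ , C⊆) = finite-intersection 𝓩 {φ = λ s r → (s ∙ r) ∈ B} (All.universal B∈ ss)
              in upward 𝓩 (λ {r} → C⊆ {r}) C∈
        in common-point em 𝓩 {φ = λ B r → All (λ s → (s ∙ r) ∈ B) ss}
             (all-translates A A∈ ∷ All.map (λ {B} B∈ → all-translates B (𝓕-translate∈𝓩 B∈)) xs∈)

      -- By definition of the product, an ultrafilter `𝓦` contains this set exactly when A is in
      -- `𝓦 · 𝓩`.
      returning : ∃ (sets 𝓥) → Pred S ℓ
      returning (A , _) s = (λ r → (s ∙ r) ∈ A) ∈ sets 𝓩

      returning-inhabited : ∀ {A} → A ∈ sets 𝓥 → ∃ λ s → (λ r → (s ∙ r) ∈ A) ∈ sets 𝓩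
      returning-inhabited {A} A∈ = decidable-stable em λ none →
        proper 𝓥 (upward 𝓥 (λ (a , ¬a) → contradiction a ¬a)
          (intersects 𝓥 A∈ (𝓕⊆𝓥 (maximal-𝓩 λ s →
            [ (λ sA∈ → contradiction (s , sA∈) none) , id ]′ (ultra 𝓩 (λ r → (s ∙ r) ∈ A))))))

      returning-FIP : FIP em ext returning
      returning-FIP is =
        let (A , A∈ , A⊆) = finite-intersection 𝓥 {φ = proj₁} (All.universal proj₂ is)
            (s , s∈) = returning-inhabited A∈
        in s , All.tabulate λ i∈ → upward 𝓩 (λ {r} sr∈A → All.lookup (A⊆ {s ∙ r} sr∈A) i∈) s∈

      -- By maximality of 𝓕 the left ideal of 𝓧 · 𝓥 leads back to 𝓥: if all translates of
      -- ∁ A were in 𝓧 · 𝓥, then ∁ A would be in 𝓕 ⊆ 𝓥.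

      returns : ∃ λ 𝓦 → (𝓦 · 𝓩) ≈ 𝓥
      returns =
        let (𝓦 , returning∈𝓦) = ultrafilter-lemma em ext returning returning-FIP
            (p , q) = ultrafilters-maximal 𝓥 (𝓦 · 𝓩) (λ A∈ → returning∈𝓦 (_ , A∈))
        in 𝓦 , q , p

  -- The ideal of ultrafilters above `𝓥`, and the two inclusions.

  above-isTwoSidedIdeal : ∀ 𝓥 → IsTwoSidedIdeal βS (Below (Translations _∙_) 𝓥)
  above-isTwoSidedIdeal 𝓥 = record
    { respects = λ (_ , 𝓧⊇𝓨) 𝓥≤𝓧 B B∈ → 𝓥≤𝓧 B (𝓧⊇𝓨 B∈)
    ; nonempty = 𝓥 , λ B B∈ → B , B∈ , λ F F⊆B →
        id , (ε , λ s → sym (identityʳ s)) , map⁺ F⊆B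
    -- One s suffices; commutativity turns left multiplication by s into a right translation.
    ; left     = λ 𝓧 𝓥≤𝓨 B B∈ →
        let (s , sB∈) = ultrafilter-inhabited em 𝓧 B∈
            (A , A∈ , A≤sB) = 𝓥≤𝓨 _ sB∈
        in A , A∈ , λ F F⊆A →
          let (f , (r , f≗) , fF⊆) = A≤sB F F⊆A
          in (_∙ (r ∙ s)) , (r ∙ s , λ _ → refl) ,
             map⁺ (All.map (λ {a} → subst B
               (trans (cong (s ∙_) (f≗ a)) (trans (comm s (a ∙ r)) (assoc a r s)))) (map⁻ fF⊆))
    -- For each of the finitely many a in F, the t with `(a ∙ r) ∙ t` in B form a set in `𝓧`; a
    -- common t gives the translation by `r ∙ t`.
    ; right    = λ 𝓧 𝓥≤𝓨 B B∈ →
        let (A , A∈ , A≤C) = 𝓥≤𝓨 _ B∈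
        in A , A∈ , λ F F⊆A →
          let (f , (r , f≗) , fF⊆) = A≤C F F⊆A
              (t , t∈) = common-point em 𝓧 (map⁻ fF⊆)
          in (_∙ (r ∙ t)) , (r ∙ t , λ _ → refl) ,
             map⁺ (All.map (λ {a} → subst B (trans (cong (_∙ t) (f≗ a)) (assoc a r t))) t∈)
    }

  -- `Below` is tested one B at a time, so each B in `𝓤` can be tested at a point of K in the basic
  -- open set of B.
  closure-K⊆maximal : Closure (K βS) ⊆ Maximal (Translations _∙_)
  closure-K⊆maximal {𝓤} 𝓤∈cl 𝓥 B B∈ =
    let (𝓧 , lift B∈𝓧 , 𝓧∈K) = 𝓤∈cl (λ 𝓧 → Lift _ (B ∈ sets 𝓧))
                                   (λ (lift B∈𝓧) → B , B∈𝓧 , lift) (lift B∈)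
    in 𝓧∈K _ (above-isTwoSidedIdeal 𝓥) B B∈𝓧

  maximal⊆closure-K : Maximal (Translations _∙_) ⊆ Closure (K βS)
  maximal⊆closure-K {𝓤} 𝓤-max O O-open 𝓤∈O =
    let (𝓥 , 𝓥∈K) = K-satisfiable
        (B , B∈𝓤 , B⊆O) = O-open 𝓤∈O
        (A , A∈𝓥 , A≤B) = 𝓤-max 𝓥 B B∈𝓤
        (𝓦 , B∈𝓦) = ultrafilter-lemma em ext {I = ∃ A} (λ (s , _) r → (s ∙ r) ∈ B) (fip A≤B)
    in 𝓥 · 𝓦 , B⊆O (upward 𝓥 (λ s∈A → B∈𝓦 (_ , s∈A)) A∈𝓥) , K-rightIdeal 𝓦 𝓥∈K
    where
    fip : ∀ {A B} → Embeds (Translations _∙_) A B →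
      FIP em ext {I = ∃ A} (λ (s , _) r → (s ∙ r) ∈ B)
    fip {B = B} A≤B is =
      let (f , (r , f≗) , f⊆) = A≤B (map proj₁ is) (map⁺ (All.universal proj₂ is))
      in r , All.map (λ {i} → subst B (f≗ (proj₁ i))) (map⁻ (map⁻ f⊆))

theorem4p13 : (∀ {a} → ExcludedMiddle a) → (∀ {a b} → Extensionality a b) →
    ∀ {ℓ} {S : Set ℓ} {_∙_ : Op₂ S} {ε : S} (isCM : IsCommutativeMonoid _≡_ _∙_ ε) →
    Maximal (Translations _∙_) ≐ Closure (K (β (IsCommutativeMonoid.isSemigroup isCM)))
theorem4p13 em ext isCM = maximal⊆closure-K em ext isCM , closure-K⊆maximal em ext isCM
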